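{- Let $\mathcal{V}$ be a variety with a $\mathsf{d}$-cube term ($\mathsf{d}>1$). Let $\mathbf{B}$ be a subalgebra of $\mathbf{B}_1\times\dots\times\mathbf{B}_n$ with $\mathbf{B}_1,\dots,\mathbf{B}_n\in\mathcal{V}$ and $n\ge\mathsf{d}$, let $\theta_i\in\operatorname{Con}(\mathbf{B}_i)$ for $i\in[n]$, and let $\theta:=\theta_1\times\dots\times\theta_n$. Assume $G$ is a generating set for $\mathbf{B}$ and $\Lambda,\Phi\subseteq B[\theta]$ satisfy: (1) for every $I\in\binom{[n]}{\mathsf{d}-1}$, every $\bar b\in B|_I$ and every $\bar c\in B[\theta]|_I$ with $\bar b\equiv_{\theta|_I}\bar c$, there exist $b_{I,\bar b}\in B$ and $c_{I,\bar c}\in\Lambda$ with $b_{I,\bar b}|_I=\bar b$, $c_{I,\bar c}|_I=\bar c$ and $b_{I,\bar b}\equiv_\theta c_{I,\bar c}$; (2) for every $i\in[n]$ and every $(\beta,\gamma)\in\theta_i$ with $\beta\in B|_i$, there exist $b_{i,\beta}\in B$ and $c_{i,\gamma}\in\Phi$ with $b_{i,\beta}|_i=\beta$, $c_{i,\gamma}|_i=\gamma$, $b_{i,\beta}|_{[i-1]}=c_{i,\gamma}|_{[i-1]}$ and $b_{i,\beta}\equiv_\theta c_{i,\gamma}$. Then $G\cup\Lambda\cup\Phi$ is a generating set for $\mathbf{B}[\theta]$.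
   Context: $[m]=\{1,\dots,m\}$; $\binom{S}{k}$ is the set of $k$-element subsets of $S$; $b|_I$ (resp. $B|_I$) denotes projection onto the coordinates in $I$, and $\theta|_I=\prod_{i\in I}\theta_i$. A $\mathsf{d}$-cube term for $\mathcal{V}$ is a term $t$ satisfying identities $t(M)=(y,\dots,y)^T$ where $M$ is a matrix with $\mathsf{d}$ rows, entries among the variables $x,y$, each column containing at least one $x$. $\theta=\theta_1\times\dots\times\theta_n$ is the product congruence relating tuples coordinatewise. For a congruence $\theta$ of an algebra $\mathbf{A}$ and a subalgebra $\mathbf{B}$, $\mathbf{B}[\theta]$ is the smallest subalgebra of $\mathbf{A}$ containing $\mathbf{B}$ that is a union of $\theta$-classes; its universe is $B[\theta]=\bigcup_{b\in B}b/\theta$. -}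

module Defs where

open import Data.Nat using (ℕ; _∸_)
open import Data.Fin using (Fin; _<_)
open import Data.Fin.Subset using (Subset; _∈_; ∣_∣)
open import Data.Bool using (Bool; true; false; if_then_else_)
open import Data.Product using (Σ; ∃; _×_; _,_)
open import Data.Sum using (_⊎_)
open import Relation.Binary.PropositionalEquality using (_≡_)
open import Function.Bundles using (_⇔_)
open import Relation.Binary.Structures using (IsEquivalence)

record Signature : Set₁ where
  field
    Op    : Set
    arity : Op → ℕ
open Signature public

module _ (σ : Signature) where

  record Algebra : Set₁ where
    field
      Carrier : Set
      op      : (f : Op σ) → (Fin (arity σ f) → Carrier) → Carrier
  open Algebra public

  data Term (X : Set) : Set where
    var : X → Term X
    app : (f : Op σ) → (Fin (arity σ f) → Term X) → Term X

  eval : {X : Set} (A : Algebra) → (X → Carrier A) → Term X → Carrier A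
  eval A env (var x)      = env x
  eval A env (app f args) = op A f (λ k → eval A env (args k))

  -- Varieties as equational classes (Birkhoff): given by a family of
  -- identities between terms in countably many variables.

  record Variety : Set₁ where
    field
      Ids : Set
      lhs : Ids → Term ℕ
      rhs : Ids → Term ℕ
  open Variety public

  _∈V_ : Algebra → Variety → Set
  A ∈V 𝒱 = ∀ (e : Ids 𝒱) (env : ℕ → Carrier A) →
            eval A env (lhs 𝒱 e) ≡ eval A env (rhs 𝒱 e)

  -- t is a d-cube term for 𝒱: t is m-ary, M is a d × m matrix over {x,y}
  -- (true = x, false = y), every column contains an x, and 𝒱 satisfies
  -- t(row r of M) ≈ y for every row r.
  IsCubeTerm : Variety → (d m : ℕ) → Term (Fin m) → (Fin d → Fin m → Bool) → Set₁
  IsCubeTerm 𝒱 d m t M =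
    (∀ (j : Fin m) → ∃ λ (r : Fin d) → M r j ≡ true) ×
    (∀ (A : Algebra) → A ∈V 𝒱 → ∀ (x y : Carrier A) (r : Fin d) →
       eval A (λ j → if M r j then x else y) t ≡ y)

  HasCubeTerm : Variety → ℕ → Set₁
  HasCubeTerm 𝒱 d = Σ ℕ λ m → Σ (Term (Fin m)) λ t →
                     Σ (Fin d → Fin m → Bool) λ M → IsCubeTerm 𝒱 d m t M

  record IsCongruence (A : Algebra) (θ : Carrier A → Carrier A → Set) : Set where
    field
      isEquivalence : IsEquivalence θ
      compatible    : ∀ (f : Op σ) (as bs : Fin (arity σ f) → Carrier A) →
                      (∀ k → θ (as k) (bs k)) → θ (op A f as) (op A f bs)

  module Product {n : ℕ} (Bs : Fin n → Algebra) where

    Tuple : Set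
    Tuple = (i : Fin n) → Carrier (Bs i)

    _≐_ : Tuple → Tuple → Set
    a ≐ b = ∀ i → a i ≡ b i

    prodOp : (f : Op σ) → (Fin (arity σ f) → Tuple) → Tuple
    prodOp f args i = op (Bs i) f (λ k → args k i)

    IsSubuniverse : (Tuple → Set) → Set
    IsSubuniverse B = ∀ (f : Op σ) (args : Fin (arity σ f) → Tuple) →
                      (∀ k → B (args k)) → B (prodOp f args)

    -- the subuniverse generated by X (sets of tuples up to coordinatewise equality)
    data Sg (X : Tuple → Set) : Tuple → Set where
      gen : ∀ {x y} → X x → x ≐ y → Sg X y
      app : ∀ {y} (f : Op σ) (args : Fin (arity σ f) → Tuple) →
            (∀ k → Sg X (args k)) → prodOp f args ≐ y → Sg X y

    Generates : (Tuple → Set) → (Tuple → Set) → Set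
    Generates G B = ∀ x → B x ⇔ Sg G x

    ProdRel : ((i : Fin n) → Carrier (Bs i) → Carrier (Bs i) → Set) → Tuple → Tuple → Set
    ProdRel θ a b = ∀ i → θ i (a i) (b i)

    Blowup : ((i : Fin n) → Carrier (Bs i) → Carrier (Bs i) → Set) →
             (Tuple → Set) → Tuple → Set
    Blowup θ B x = ∃ λ b → B b × ProdRel θ b x

    EqOn : Subset n → Tuple → Tuple → Set
    EqOn I a b = ∀ i → i ∈ I → a i ≡ b i

    RelOn : ((i : Fin n) → Carrier (Bs i) → Carrier (Bs i) → Set) →
            Subset n → Tuple → Tuple → Set
    RelOn θ I a b = ∀ i → i ∈ I → θ i (a i) (b i)

    _∪_∪_ : (Tuple → Set) → (Tuple → Set) → (Tuple → Set) → Tuple → Set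
    (X ∪ Y ∪ Z) x = X x ⊎ Y x ⊎ Z x

{-# OPTIONS --safe #-}
module Submission where

-- Enlarge a set J of coordinates one step at a time: given b ∈ B and c ≡ b mod θ, find b′ ∈ B and
-- c′ in the subalgebra generated by G ∪ Λ ∪ Φ with b′ ≡ c′ mod θ that agree with b and c on J.
-- If |J| < d this is hypothesis (1).  Otherwise let k = max J; a (1, d-1)-parallelogram term
-- combines approximations on proper subsets of J with a fork at k, and hypothesis (2)
-- supplies the forks.
--
-- The parallelogram term is obtained from the cube term as follows.  A column is identified with
-- the set of rows where it has an x.  If y is generated from all nonempty columns then, removing
-- rows j = d-1, …, 1 in turn, it is generated from the nonempty subsets of {0, …, j-1} together with
-- {i} and {0, i} for all i: replace the values x by b₀ = x, bᵢ = t(y at column {0}, x elsewhere) for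
-- 0 < i < j, and bⱼ = t(x at column {0}, y elsewhere).  The final family is the star {0}, {i}, {0, i},
-- and one more substitution of the star term into itself gives the parallelogram term.
--
-- Without function extensionality, the identities of a term are only available for environments
-- that are literally rows of its matrix.  All terms are therefore applied to tuples of a relation R
-- closed under coordinatewise equality, which allows to choose the representing environments.

open import Defs
open import Data.Nat using (ℕ; _∸_; _≤_; _<_)
open import Data.Fin using (Fin) renaming (_<_ to _<ᶠ_)
open import Data.Fin.Subset using (Subset; ∣_∣)
open import Data.Product using (∃; _×_)
open import Relation.Binary.PropositionalEquality using (_≡_)

open import Data.Bool using (Bool; true; false; if_then_else_; _∧_; not)
import Data.Bool.Properties as Bool
open import Data.Nat using (zero; suc; _+_; z≤n; s≤s)
import Data.Nat.Properties as ℕ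
open import Data.Fin using (zero; suc; toℕ; fromℕ<; fromℕ; inject₁) renaming (_≤_ to _≤ᶠ_)
import Data.Fin.Properties as Fin
open import Data.Fin.Subset using (_∈_; _-_; ⊤; inside; outside)
import Data.Fin.Subset.Properties as Subset
open import Data.Vec using ([]; _∷_; here; there)
open import Function.Bundles using (Equivalence; mk⇔)
open import Relation.Binary.Structures using (IsEquivalence)
open import Relation.Binary.Definitions using (tri<; tri≈; tri>)
open import Data.Product using (Σ; _,_; proj₁; proj₂)
import Data.Sum as Sum
open import Data.Sum using (_⊎_; inj₁; inj₂)
open import Data.Empty using (⊥-elim)
open import Relation.Nullary using (¬_; Dec; yes; no; does)
open import Relation.Nullary.Decidable using (_×-dec_; ¬?)
open import Relation.Binary.PropositionalEquality using (refl; sym; trans; cong; subst; _≢_)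

-- Terms seen through their behaviour at single coordinates.

-- The behaviour of a term at one coordinate: either the arguments form row r of its matrix at
-- (x , y), so that the value is y, or they are arbitrary.
data Kind (d : ℕ) (C X : Set) : Set where
  row : Fin d → X → X → Kind d C X
  gen : (C → X) → Kind d C X

module _ {d : ℕ} {C X : Set} where

  entry : (C → Fin d → Bool) → Kind d C X → C → X
  entry inc (row r x y) c = if inc c r then x else y
  entry inc (gen e)     c = e c

  result : ((C → X) → X) → Kind d C X → X
  result G (row r x y) = y
  result G (gen e)     = G e

-- Substituting a term into itself: pat r describes the new x in row r, and the other entries
-- of each inner application are y, by an identity of the term or because all arguments are y.
record Substitution {d : ℕ} {C C′ : Set}
                    (inc : C → Fin d → Bool) (inc′ : C′ → Fin d → Bool) : Set where
  field
    arg : C → C → C′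
    pat : Fin d → C → Bool
    on  : ∀ T r → inc T r ≡ true → ∀ S → inc′ (arg T S) r ≡ pat r S
    off : ∀ T r → inc T r ≡ false →
          (∃ λ r′ → ∀ S → inc′ (arg T S) r ≡ inc S r′) ⊎ (∀ S → inc′ (arg T S) r ≡ false)

data Star (e : ℕ) : Set where
  ctr       : Star e
  leaf edge : Fin e → Star e

incStar : ∀ {e} → Star e → Fin (suc e) → Bool
incStar ctr      zero    = true
incStar ctr      (suc s) = false
incStar (leaf r) zero    = false
incStar (leaf r) (suc s) = does (r Fin.≟ s)
incStar (edge r) zero    = true
incStar (edge r) (suc s) = does (r Fin.≟ s)

if-same : ∀ {X : Set} (b : Bool) {x : X} → x ≡ (if b then x else x)
if-same true  = refl
if-same false = refl

-- From all nonempty columns down to the star.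

module Columns (e : ℕ) where

  Col : Set
  Col = Fin (suc e) → Bool

  -- The nonempty subsets of {0, …, j-1} and the sets {i}, {0, i}.
  IsColumn : ℕ → Col → Set
  IsColumn j S = (∃ λ r → S r ≡ true) ×
    (∀ r r′ → j ≤ toℕ r → S r ≡ true → S r′ ≡ true → r′ ≡ r ⊎ r′ ≡ zero)

  Column : ℕ → Set
  Column j = Σ Col (IsColumn j)

  incCol : ∀ {j} → Column j → Col
  incCol = proj₁

  leaf? : (S : Col) → Dec (∃ λ r → S (suc r) ≡ true)
  leaf? S = Fin.any? (λ r → S (suc r) Bool.≟ true)

  columnToStar : Column 1 → Star e
  columnToStar (S , _) with leaf? S
  ... | no  _       = ctr
  ... | yes (r , _) = if S zero then edge r else leaf r

  -- At level 1 every nonzero row is isolated, so a column has at most one x outside row 0 and it is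
  -- immaterial how `leaf?` searches for it.
  columnToStar-inc : ∀ c r → incStar (columnToStar c) r ≡ incCol c r
  columnToStar-inc (S , (s , Ss) , iso) r with leaf? S
  columnToStar-inc (S , (zero , Ss) , iso)  zero    | no _  = sym Ss
  columnToStar-inc (S , (suc s , Ss) , iso) zero    | no ∄r = ⊥-elim (∄r (s , Ss))
  columnToStar-inc (S , (s , Ss) , iso)     (suc r) | no ∄r = sym (Bool.¬-not (λ Sr → ∄r (r , Sr)))
  columnToStar-inc (S , _ , iso) zero | yes (t , St) with S zero
  ... | true  = refl
  ... | false = refl
  columnToStar-inc (S , _ , iso) (suc r) | yes (t , St) = trans (forget (S zero)) same
    where
    forget : ∀ b → incStar (if b then edge t else leaf t) (suc r) ≡ does (t Fin.≟ r)
    forget true  = refl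
    forget false = refl
    same : does (t Fin.≟ r) ≡ S (suc r)
    same with t Fin.≟ r
    ... | yes refl = sym St
    ... | no t≢r   = sym (Bool.¬-not λ Sr → distinct (iso (suc r) (suc t) (s≤s z≤n) Sr St))
      where
      distinct : ¬ (suc t ≡ suc r ⊎ suc t ≡ zero)
      distinct (inj₁ refl) = t≢r refl

  module Peel (J : Fin e) where

    -- Write j for `suc J`, the row being removed. On nonempty columns `leaf? S` fails only for {0}.
    -- With true read as x, the cases are b₀, bⱼ and bᵢ for 0 < i < j; rows beyond j keep x.
    pat : Fin (suc e) → Col → Bool
    pat zero    S = true
    pat (suc r) S with r Fin.≟ J | r Fin.<? J
    ... | yes _ | _     = not (does (leaf? S))
    ... | no _  | yes _ = does (leaf? S)
    ... | no _  | no _  = true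

    -- Masking the pattern by T would be the natural inner column, but it can be empty when T = {j}
    -- or when T avoids both 0 and j. These cases get their own y-rows.
    data View (T : Col) : Set where
      only    : T (suc J) ≡ true → (∀ r → r ≢ suc J → T r ≡ false) → View T
      with-J  : ∀ r → T (suc J) ≡ true → T r ≡ true → r ≢ suc J → View T
      with-0  : T (suc J) ≡ false → T zero ≡ true → View T
      neither : T (suc J) ≡ false → T zero ≡ false → View T

    view : ∀ T → View T
    view T with T (suc J) in TJ | T zero in T0
    ... | false | true  = with-0 TJ T0
    ... | false | false = neither TJ T0
    ... | true  | _ with Fin.any? (λ r → (T r Bool.≟ true) ×-dec ¬? (r Fin.≟ suc J))
    ...   | yes (r , Tr , r≢J) = with-J r TJ Tr r≢J
    ...   | no ∄r = only TJ (λ r r≢J → Bool.¬-not (λ Tr → ∄r (r , Tr , r≢J)))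

    argCol : ∀ T → View T → Col → Col
    -- Row j now carries the pattern, false unless S = {0}. Moving the old row j of S to row 0 keeps
    -- S = {j} nonempty.
    argCol T (only _ _) S zero = S (suc J)
    argCol T (only _ _) S (suc r) with r Fin.≟ J
    ... | yes _ = not (does (leaf? S))
    ... | no _  = S (suc r)
    argCol T (with-J _ _ _ _) S r = T r ∧ pat r S
    argCol T (with-0 _ _)     S r = T r ∧ pat r S
    -- At S = {0} the pattern is y in all rows strictly between 0 and j; row 0 then supplies the x.
    argCol T (neither _ _)    S zero    = S zero
    argCol T (neither _ _)    S (suc r) = T (suc r) ∧ pat (suc r) S

    pat-J : ∀ S → pat (suc J) S ≡ not (does (leaf? S))
    pat-J S with J Fin.≟ J
    ... | yes _  = refl
    ... | no J≢J = ⊥-elim (J≢J refl)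

    on : ∀ T (ν : View T) r → T r ≡ true → ∀ S → argCol T ν S r ≡ pat r S
    on T (only TJ T≢J) r Tr S with r Fin.≟ suc J
    on T (only TJ T≢J) r Tr S | no r≢J with () ← trans (sym (T≢J r r≢J)) Tr
    on T (only TJ T≢J) r Tr S | yes refl with J Fin.≟ J
    ... | yes _  = refl
    ... | no J≢J = ⊥-elim (J≢J refl)
    on T (with-J _ _ _ _) r Tr S = cong (_∧ pat r S) Tr
    on T (with-0 _ _)     r Tr S = cong (_∧ pat r S) Tr
    on T (neither _ T0) zero    Tr S with () ← trans (sym T0) Tr
    on T (neither _ _)  (suc r) Tr S = cong (_∧ pat (suc r) S) Tr

    off : ∀ T (ν : View T) r → T r ≡ false →
          (∃ λ r′ → ∀ S → argCol T ν S r ≡ S r′) ⊎ (∀ S → argCol T ν S r ≡ false)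
    off T (only TJ T≢J) zero    ¬Tr = inj₁ (suc J , λ S → refl)
    off T (only TJ T≢J) (suc r) ¬Tr = inj₁ (suc r , same)
      where
      same : ∀ S → argCol T (only TJ T≢J) S (suc r) ≡ S (suc r)
      same S with r Fin.≟ J
      ... | yes refl with () ← trans (sym ¬Tr) TJ
      ... | no _ = refl
    off T (with-J _ _ _ _) r ¬Tr = inj₂ (λ S → cong (_∧ pat r S) ¬Tr)
    off T (with-0 _ _)     r ¬Tr = inj₂ (λ S → cong (_∧ pat r S) ¬Tr)
    off T (neither _ _) zero    ¬Tr = inj₁ (zero , λ S → refl)
    off T (neither _ _) (suc r) ¬Tr = inj₂ (λ S → cong (_∧ pat (suc r) S) ¬Tr)

    ∧-true : ∀ a {b} → a ∧ b ≡ true → a ≡ true × b ≡ true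
    ∧-true true p = refl , p

    ∧-intro : ∀ {a b} → a ≡ true → b ≡ true → a ∧ b ≡ true
    ∧-intro refl p = p

    pat-other : ∀ r S → r ≢ suc J → (∃ λ s → S (suc s) ≡ true) → pat r S ≡ true
    pat-other zero    S r≢J ∃s = refl
    pat-other (suc r) S r≢J ∃s with r Fin.≟ J | r Fin.<? J
    ... | yes refl | _ = ⊥-elim (r≢J refl)
    ... | no _ | no _ = refl
    ... | no _ | yes _ with leaf? S
    ...   | yes _ = refl
    ...   | no ∄s = ⊥-elim (∄s ∃s)

    pat-J-ctr : ∀ S → ¬ (∃ λ s → S (suc s) ≡ true) → pat (suc J) S ≡ true
    pat-J-ctr S ∄s rewrite pat-J S with leaf? S
    ... | yes ∃s = ⊥-elim (∄s ∃s)
    ... | no _   = refl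

    above : ∀ {r : Fin e} → r ≢ J → toℕ (suc J) ≤ suc (toℕ r) → suc (toℕ (suc J)) ≤ suc (toℕ r)
    above r≢J (s≤s J≤r) = s≤s (ℕ.≤∧≢⇒< J≤r (λ eq → r≢J (sym (Fin.toℕ-injective eq))))

    nonempty : ∀ T (ν : View T) S → IsColumn (suc (toℕ (suc J))) T → IsColumn (suc (toℕ (suc J))) S →
               ∃ λ r → argCol T ν S r ≡ true
    nonempty T ν S colT colS with leaf? S
    nonempty T (only TJ T≢J) S colT colS | yes (s , Ss) with s Fin.≟ J
    ... | yes refl = zero , Ss
    ... | no s≢J   = suc s , same
      where
      same : argCol T (only TJ T≢J) S (suc s) ≡ true
      same with s Fin.≟ J
      ... | yes s≡J = ⊥-elim (s≢J s≡J)
      ... | no _    = Ss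
    nonempty T (only TJ T≢J) S colT colS | no ∄s =
      suc J , trans (on T (only TJ T≢J) (suc J) TJ S) (pat-J-ctr S ∄s)
    nonempty T (with-J r TJ Tr r≢J) S colT colS | yes ∃s = r , ∧-intro Tr (pat-other r S r≢J ∃s)
    nonempty T (with-J r TJ Tr r≢J) S colT colS | no ∄s  = suc J , ∧-intro TJ (pat-J-ctr S ∄s)
    nonempty T (with-0 TJ T0) S colT colS | _ = zero , ∧-intro T0 refl
    nonempty T (neither TJ T0) S ((zero , Tr) , _) colS | yes ∃s with () ← trans (sym T0) Tr
    nonempty T (neither TJ T0) S ((suc r , Tr) , _) colS | yes ∃s =
      suc r , ∧-intro Tr (pat-other (suc r) S (λ { refl → contra (trans (sym TJ) Tr) }) ∃s)
      where
      contra : ¬ (false ≡ true)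
      contra ()
    nonempty T (neither TJ T0) S colT ((zero , Ss) , _)  | no ∄s = zero , Ss
    nonempty T (neither TJ T0) S colT ((suc s , Ss) , _) | no ∄s = ⊥-elim (∄s (s , Ss))

    -- Rows beyond j are isolated in T already. Row j has its x at S = {0}, the rows strictly
    -- between 0 and j have theirs at all other S, so they never meet.
    masked-isolated : ∀ T S → IsColumn (suc (toℕ (suc J))) T → ∀ r r′ → toℕ (suc J) ≤ suc (toℕ r) →
               T (suc r) ∧ pat (suc r) S ≡ true → T (suc r′) ∧ pat (suc r′) S ≡ true → r′ ≡ r
    masked-isolated T S (_ , iso) r r′ J≤r p p′
      with ∧-true (T (suc r)) p | ∧-true (T (suc r′)) p′
    ... | Tr , pr | Tr′ , pr′ with r Fin.≟ J
    ...   | no r≢J with iso (suc r) (suc r′) (above r≢J J≤r) Tr Tr′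
    ...     | inj₁ refl = refl
    masked-isolated T S (_ , iso) r r′ J≤r p p′ | Tr , pr | Tr′ , pr′ | yes refl
      with r′ Fin.≟ J | r′ Fin.<? J
    ... | yes refl | _ = refl
    ... | no _ | yes _ with leaf? S
    masked-isolated T S (_ , iso) r r′ J≤r p p′ | Tr , () | Tr′ , pr′ | yes refl | no _ | yes _ | yes _
    masked-isolated T S (_ , iso) r r′ J≤r p p′ | Tr , pr | Tr′ , () | yes refl | no _ | yes _ | no _
    masked-isolated T S (_ , iso) r r′ J≤r p p′ | Tr , pr | Tr′ , pr′ | yes refl | no r′≢J | no r′≮J
      with iso (suc r′) (suc J) (above r′≢J (s≤s (ℕ.≮⇒≥ r′≮J))) Tr′ Tr
    ... | inj₁ refl = refl

    -- In case `only`, row j is hit just for S = {0}, which meets no other positive row; beyond j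
    -- the isolation is that of S.
    isolated : ∀ T (ν : View T) S → IsColumn (suc (toℕ (suc J))) T → IsColumn (suc (toℕ (suc J))) S →
               ∀ r r′ → toℕ (suc J) ≤ toℕ r →
               argCol T ν S r ≡ true → argCol T ν S r′ ≡ true → r′ ≡ r ⊎ r′ ≡ zero
    isolated T ν S colT colS r zero J≤r p p′ = inj₂ refl
    isolated T (only TJ T≢J) S colT (_ , iso) (suc r) (suc r′) J≤r p p′
      with r Fin.≟ J | r′ Fin.≟ J
    ... | yes refl | yes refl = inj₁ refl
    ... | yes refl | no _ with leaf? S
    ...   | no ∄s = ⊥-elim (∄s (r′ , p′))
    isolated T (only TJ T≢J) S colT (_ , iso) (suc r) (suc r′) J≤r p p′ | no _ | yes refl with leaf? S
    ...   | no ∄s = ⊥-elim (∄s (r , p))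
    isolated T (only TJ T≢J) S colT (_ , iso) (suc r) (suc r′) J≤r p p′ | no r≢J | no _ =
      iso (suc r) (suc r′) (above r≢J J≤r) p p′
    isolated T (with-J _ _ _ _) S colT colS (suc r) (suc r′) J≤r p p′ =
      inj₁ (cong suc (masked-isolated T S colT r r′ J≤r p p′))
    isolated T (with-0 _ _) S colT colS (suc r) (suc r′) J≤r p p′ =
      inj₁ (cong suc (masked-isolated T S colT r r′ J≤r p p′))
    isolated T (neither _ _) S colT colS (suc r) (suc r′) J≤r p p′ =
      inj₁ (cong suc (masked-isolated T S colT r r′ J≤r p p′))

    peel : Substitution (incCol {suc (toℕ (suc J))}) (incCol {toℕ (suc J)})
    peel = record
      { arg = λ { (T , colT) (S , colS) →
                  argCol T (view T) S
                , nonempty T (view T) S colT colS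
                , isolated T (view T) S colT colS }
      ; pat = λ { r (S , _) → pat r S }
      ; on  = λ { (T , _) r Tr (S , _) → on T (view T) r Tr S }
      ; off = λ { (T , _) r ¬Tr → Sum.map (λ { (r′ , p) → r′ , λ S → p (proj₁ S) })
                                          (λ p S → p (proj₁ S)) (off T (view T) r ¬Tr) }
      }

-- Closure of a relation under terms, and the parallelogram term.

module Schemes {σ : Signature} {K : Set} (A : K → Algebra σ)
               (R : (∀ i → Carrier (A i)) → Set)
               (R-resp : ∀ {a b} → (∀ i → a i ≡ b i) → R a → R b) where

  -- Stands for a term together with its identities: in `closed` each coordinate chooses its own row
  -- and values, and the identity is already applied there.
  record Scheme (d : ℕ) (C : Set) (inc : C → Fin d → Bool) : Set where
    field
      G      : ∀ i → (C → Carrier (A i)) → Carrier (A i)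
      closed : (κ : ∀ i → Kind d C (Carrier (A i))) →
               (∀ c → R (λ i → entry inc (κ i) c)) → R (λ i → result (G i) (κ i))

  module _ {d : ℕ} where

    reindex : ∀ {C C′} {inc : C → Fin d → Bool} {inc′ : C′ → Fin d → Bool} (f : C → C′) →
              (∀ c r → inc′ (f c) r ≡ inc c r) → Scheme d C inc → Scheme d C′ inc′
    reindex {C} {C′} {inc} {inc′} f f-inc 𝒮 = record
      { G      = λ i e → G i (λ c → e (f c))
      ; closed = λ κ H → R-resp (λ i → same-result i (κ i))
                   (closed (λ i → pull (κ i)) (λ c → R-resp (λ i → same-entry (κ i) c) (H (f c))))
      }
      where
      open Scheme 𝒮
      pull : ∀ {X} → Kind d C′ X → Kind d C X
      pull (row r x y) = row r x y
      pull (gen e)     = gen (λ c → e (f c))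
      same-entry : ∀ {X} (κ : Kind d C′ X) c → entry inc′ κ (f c) ≡ entry inc (pull κ) c
      same-entry (row r x y) c rewrite f-inc c r = refl
      same-entry (gen e)     c = refl
      same-result : ∀ i (κ : Kind d C′ (Carrier (A i))) →
                    result (G i) (pull κ) ≡ result (λ e → G i (λ c → e (f c))) κ
      same-result i (row r x y) = refl
      same-result i (gen e)     = refl

    substitute : ∀ {C C′} {inc : C → Fin d → Bool} {inc′ : C′ → Fin d → Bool} →
                 Substitution inc inc′ → Scheme d C inc → Scheme d C′ inc′
    substitute {C} {C′} {inc} {inc′} s 𝒮 = record
      { G      = G′
      ; closed = λ κ H → R-resp (λ i → outer-result i (κ i))
                   (closed (λ i → outer i (κ i)) (λ T →
                      R-resp (λ i → proj₂ (proj₂ (inner T i (κ i))))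
                        (closed (λ i → proj₁ (inner T i (κ i))) (λ S →
                           R-resp (λ i → proj₁ (proj₂ (inner T i (κ i))) S) (H (arg T S))))))
      }
      where
      open Scheme 𝒮
      open Substitution s
      G′ : ∀ i → (C′ → Carrier (A i)) → Carrier (A i)
      G′ i e = G i (λ T → G i (λ S → e (arg T S)))
      outer : ∀ i → Kind d C′ (Carrier (A i)) → Kind d C (Carrier (A i))
      outer i (row r x y) = row r (G i (λ S → if pat r S then x else y)) y
      outer i (gen e)     = gen (λ T → G i (λ S → e (arg T S)))
      outer-result : ∀ i κ → result (G i) (outer i κ) ≡ result (G′ i) κ
      outer-result i (row r x y) = refl
      outer-result i (gen e)     = refl
      inner : ∀ T i (κ : Kind d C′ (Carrier (A i))) →
              Σ (Kind d C (Carrier (A i))) λ k →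
                (∀ S → entry inc′ κ (arg T S) ≡ entry inc k S) ×
                result (G i) k ≡ entry inc (outer i κ) T
      inner T i (gen e) = gen (λ S → e (arg T S)) , (λ S → refl) , refl
      inner T i (row r x y) with inc T r in eq
      ... | true  = gen (λ S → if pat r S then x else y) ,
                    (λ S → cong (λ b → if b then x else y) (on T r eq S)) , refl
      ... | false with off T r eq
      ...   | inj₁ (r′ , p) = row r′ x y , (λ S → cong (λ b → if b then x else y) (p S)) , refl
      -- All arguments are y; a row with x = y expresses idempotence.
      ...   | inj₂ p        = row r y y ,
                              (λ S → trans (cong (λ b → if b then x else y) (p S)) (if-same (inc S r))) ,
                              refl

  module Parallelogram {e : ℕ} (𝒮 : Scheme (suc e) (Star e) incStar) (Dom : K → Set)
                       (u v w y : ∀ i → Carrier (A i)) (z : Fin e → ∀ i → Carrier (A i)) where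

    open Scheme 𝒮

    -- Rows of the identity in the arguments (u, v, w | z): `head` is (x, x, y | y, ..., y) and
    -- `tail r` is (y, x, x | y, ..., z, ..., y) with z in place r.
    data Role (i : K) : Set where
      free : ¬ Dom i → Role i
      head : u i ≡ v i → w i ≡ y i → (∀ r → z r i ≡ y i) → Role i
      tail : ∀ r → u i ≡ y i → v i ≡ w i → (∀ s → s ≢ r → z s i ≡ y i) → Role i

    parallelogram : (∀ i → Role i) → R u → R v → R w → (∀ r → R (z r)) →
                    ∃ λ a → R a × (∀ i → Dom i → a i ≡ y i)
    parallelogram role Ru Rv Rw Rz =
        _
      , closed (λ i → outer i (role i)) (λ T →
          R-resp (λ i → proj₂ (proj₂ (inner T i (role i))))
            (closed (λ i → proj₁ (inner T i (role i))) (λ S →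
               R-resp (λ i → proj₁ (proj₂ (inner T i (role i))) S) (R-arg T S))))
      , λ i → on-domain i (role i)
      where
      -- The new x is star(y at {0}, u elsewhere) in row 0 and star(z r at {0}, y elsewhere) in row r.
      arg : Star e → Star e → ∀ i → Carrier (A i)
      arg ctr      ctr      = w
      arg ctr      (edge _) = v
      arg ctr      (leaf _) = u
      arg (edge r) ctr      = z r
      arg (edge r) (edge _) = u
      arg (edge r) (leaf _) = u
      arg (leaf r) ctr      = z r
      arg (leaf r) (edge s) = if does (s Fin.≟ r) then u else z s
      arg (leaf r) (leaf s) = if does (s Fin.≟ r) then u else z s

      R-arg : ∀ T S → R (arg T S)
      R-arg ctr      ctr      = Rw
      R-arg ctr      (edge _) = Rv
      R-arg ctr      (leaf _) = Ru
      R-arg (edge r) ctr      = Rz r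
      R-arg (edge r) (edge _) = Ru
      R-arg (edge r) (leaf _) = Ru
      R-arg (leaf r) ctr      = Rz r
      R-arg (leaf r) (edge s) with does (s Fin.≟ r)
      ... | true  = Ru
      ... | false = Rz s
      R-arg (leaf r) (leaf s) with does (s Fin.≟ r)
      ... | true  = Ru
      ... | false = Rz s

      atCtr : ∀ {X : Set} → X → X → Star e → X
      atCtr x x′ ctr      = x
      atCtr x x′ (leaf _) = x′
      atCtr x x′ (edge _) = x′

      outer : ∀ i → Role i → Kind (suc e) (Star e) (Carrier (A i))
      outer i (free _)       = gen (λ T → G i (λ S → arg T S i))
      outer i (head _ _ _)   = row zero (G i (atCtr (y i) (u i))) (y i)
      outer i (tail r _ _ _) = row (suc r) (G i (atCtr (z r i) (y i))) (y i)

      on-domain : ∀ i (ρ : Role i) → Dom i → result (G i) (outer i ρ) ≡ y i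
      on-domain i (free ¬dom)    dom = ⊥-elim (¬dom dom)
      on-domain i (head _ _ _)   dom = refl
      on-domain i (tail _ _ _ _) dom = refl

      -- If T has an x in the row assigned to i, the inner application is the new x; otherwise it
      -- must collapse to y by some row of the star identity.
      inner : ∀ T i (ρ : Role i) →
              Σ (Kind (suc e) (Star e) (Carrier (A i))) λ k →
                (∀ S → arg T S i ≡ entry incStar k S) ×
                result (G i) k ≡ entry incStar (outer i ρ) T
      inner T i (free _) = gen (λ S → arg T S i) , (λ _ → refl) , refl
      inner ctr i (head u≡v w≡y z≡y) = gen (atCtr (y i) (u i)) ,
        (λ { ctr → w≡y ; (leaf _) → refl ; (edge _) → sym u≡v }) , refl
      inner (edge r) i (head u≡v w≡y z≡y) = gen (atCtr (y i) (u i)) ,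
        (λ { ctr → z≡y r ; (leaf _) → refl ; (edge _) → refl }) , refl
      -- Here u sits exactly at `leaf r` and `edge r`, the columns with an x in row `suc r`.
      inner (leaf r) i (head u≡v w≡y z≡y) = row (suc r) (u i) (y i) ,
        (λ { ctr → z≡y r ; (leaf s) → choice s ; (edge s) → choice s }) , refl
        where
        choice : ∀ s → (if does (s Fin.≟ r) then u else z s) i ≡ (if does (s Fin.≟ r) then u i else y i)
        choice s with does (s Fin.≟ r)
        ... | true  = refl
        ... | false = z≡y s
      -- By v = w, the value w fills {0} and all edges, the columns with an x in row 0.
      inner ctr i (tail r u≡y v≡w z≡y) = row zero (w i) (y i) ,
        (λ { ctr → refl ; (leaf _) → u≡y ; (edge _) → v≡w }) , refl
      inner (edge r′) i (tail r u≡y v≡w z≡y) with r′ Fin.≟ r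
      ... | yes refl = gen (atCtr (z r i) (y i)) ,
        (λ { ctr → refl ; (leaf _) → u≡y ; (edge _) → u≡y }) , refl
      ... | no r′≢r = row zero (y i) (y i) ,
        (λ { ctr → z≡y r′ r′≢r ; (leaf _) → u≡y ; (edge _) → u≡y }) , refl
      inner (leaf r′) i (tail r u≡y v≡w z≡y) with r′ Fin.≟ r
      ... | yes refl = gen (atCtr (z r i) (y i)) ,
        (λ { ctr → refl ; (leaf s) → choice s ; (edge s) → choice s }) , refl
        where
        choice : ∀ s → (if does (s Fin.≟ r) then u else z s) i ≡ y i
        choice s with s Fin.≟ r
        ... | yes _  = u≡y
        ... | no s≢r = z≡y s s≢r
      -- Only `leaf r` and `edge r` carry z r, which is why `arg` places z s at both columns of
      -- index s.
      ... | no r′≢r = row (suc r) (z r i) (y i) ,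
        (λ { ctr → z≡y r′ r′≢r ; (leaf s) → choice s ; (edge s) → choice s }) , refl
        where
        choice : ∀ s → (if does (s Fin.≟ r′) then u else z s) i ≡ (if does (s Fin.≟ r) then z r i else y i)
        choice s with s Fin.≟ r | s Fin.≟ r′
        ... | yes refl | yes refl = ⊥-elim (r′≢r refl)
        ... | yes refl | no _     = refl
        ... | no _     | yes _    = u≡y
        ... | no s≢r   | no _     = z≡y s s≢r

  module _ {e : ℕ} where

    open Columns e

    peelScheme : ∀ (J : Fin e) {j} → toℕ J ≡ j →
                 Scheme (suc e) (Column (suc (suc j))) incCol → Scheme (suc e) (Column (suc j)) incCol
    peelScheme J refl = substitute (Peel.peel J)

    -- Rows e, ..., j + 1 are peeled in this order: the recursive call stops one level above, and
    -- row `suc j` goes last.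
    descend : ∀ g j → j + g ≡ e →
              Scheme (suc e) (Column (suc e)) incCol → Scheme (suc e) (Column (suc j)) incCol
    descend zero    j eq 𝒮 with refl ← trans (sym (ℕ.+-identityʳ j)) eq = 𝒮
    descend (suc g) j eq 𝒮 =
      peelScheme (fromℕ< j<e) (Fin.toℕ-fromℕ< j<e) (descend g (suc j) 1+j+g≡e 𝒮)
      where
      1+j+g≡e : suc j + g ≡ e
      1+j+g≡e = trans (sym (ℕ.+-suc j g)) eq
      j<e : j < e
      j<e = ℕ.≤-trans (ℕ.m≤m+n (suc j) g) (ℕ.≤-reflexive 1+j+g≡e)

    starScheme : ∀ {C} {inc : C → Fin (suc e) → Bool} → (∀ c → ∃ λ r → inc c r ≡ true) →
                 Scheme (suc e) C inc → Scheme (suc e) (Star e) incStar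
    starScheme {inc = inc} hit 𝒮 =
      reindex columnToStar columnToStar-inc
        (descend e 0 refl
          -- At the top level isolation concerns rows beyond e, and there are none.
          (reindex (λ c → inc c , hit c , λ r _ e<r → ⊥-elim (ℕ.<⇒≱ (Fin.toℕ<n r) e<r))
                   (λ _ _ → refl) 𝒮))

  module _ (R-op : ∀ f (as : Fin (arity σ f) → ∀ i → Carrier (A i)) →
                   (∀ k → R (as k)) → R (λ i → op (A i) f (λ k → as k i))) where

    R-eval : ∀ {X} (a : X → ∀ i → Carrier (A i)) → (∀ x → R (a x)) →
             ∀ t → R (λ i → eval σ (A i) (λ x → a x i) t)
    R-eval a Ra (var x)    = Ra x
    R-eval a Ra (app f ts) = R-op f _ (λ k → R-eval a Ra (ts k))

    cubeScheme : ∀ {𝒱 d m t M} → (∀ i → _∈V_ σ (A i) 𝒱) → IsCubeTerm σ 𝒱 d m t M →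
                 Scheme d (Fin m) (λ c r → M r c)
    cubeScheme {t = t} A∈𝒱 (_ , cube) = record
      { G      = λ i a → eval σ (A i) a t
      ; closed = λ κ H → R-resp (λ i → same i (κ i)) (R-eval (λ c i → entry _ (κ i) c) H t)
      }
      where
      same : ∀ i κ → eval σ (A i) (entry _ κ) t ≡ result (λ a → eval σ (A i) a t) κ
      same i (row r x y) = cube (A i) (A∈𝒱 i) x y r
      same i (gen a)     = refl

-- Subsets of coordinates and updates of tuples.

maximum : ∀ {n} (p : Subset n) → 0 < ∣ p ∣ → ∃ λ k → k ∈ p × (∀ i → i ∈ p → i ≤ᶠ k)
maximum (outside ∷ p) 0<∣p∣ with k , k∈p , max ← maximum p 0<∣p∣ =
  suc k , there k∈p , λ { (suc i) (there i∈p) → s≤s (max i i∈p) }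
maximum (inside ∷ p) _ with ∣ p ∣ in ∣p∣≡
... | suc _ with k , k∈p , max ← maximum p (subst (0 <_) (sym ∣p∣≡) (s≤s z≤n)) =
  suc k , there k∈p , λ { zero _ → z≤n ; (suc i) (there i∈p) → s≤s (max i i∈p) }
... | zero = zero , here , λ { zero _ → z≤n ; (suc i) (there i∈p) → ⊥-elim (empty i∈p) }
  where
  empty : ∀ {i} → ¬ (i ∈ p)
  empty {i} i∈p with () ← subst (∣ p - i ∣ <_) ∣p∣≡ (Subset.x∈p⇒∣p-x∣<∣p∣ i∈p)

enumerate : ∀ {n} m (p : Subset n) → m ≤ ∣ p ∣ →
            ∃ λ (f : Fin m → Fin n) → (∀ r → f r ∈ p) × (∀ r s → r <ᶠ s → f r <ᶠ f s)
enumerate zero p _ = (λ ()) , (λ ()) , λ ()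
enumerate (suc m) (outside ∷ p) m<∣p∣ with f , f∈p , mono ← enumerate (suc m) p m<∣p∣ =
  (λ r → suc (f r)) , (λ r → there (f∈p r)) , λ r s r<s → s≤s (mono r s r<s)
enumerate (suc m) (inside ∷ p) (s≤s m≤∣p∣) with f , f∈p , mono ← enumerate m p m≤∣p∣ =
  (λ { zero → zero ; (suc r) → suc (f r) }) ,
  (λ { zero → here ; (suc r) → there (f∈p r) }) ,
  λ { zero (suc s) _ → s≤s z≤n ; (suc r) (suc s) (s≤s r<s) → s≤s (mono r s r<s) }

-- Hypothesis (1) speaks of exactly d-1 coordinates; smaller sets are padded.
enlarge : ∀ {n} m (p : Subset n) → ∣ p ∣ ≤ m → m ≤ n →
          ∃ λ (q : Subset n) → (∀ {i} → i ∈ p → i ∈ q) × ∣ q ∣ ≡ m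
enlarge zero [] _ _ = [] , (λ i∈p → i∈p) , refl
enlarge (suc m) (inside ∷ p) (s≤s ∣p∣≤m) (s≤s m≤n) with q , p⊆q , ∣q∣ ← enlarge m p ∣p∣≤m m≤n =
  inside ∷ q , (λ { here → here ; (there i∈p) → there (p⊆q i∈p) }) , cong suc ∣q∣
enlarge {suc n} m (outside ∷ p) ∣p∣≤m m≤1+n with ℕ.m≤n⇒m<n∨m≡n m≤1+n
... | inj₁ (s≤s m≤n) with q , p⊆q , ∣q∣ ← enlarge m p ∣p∣≤m m≤n =
  outside ∷ q , (λ { (there i∈p) → there (p⊆q i∈p) }) , ∣q∣
... | inj₂ refl = ⊤ , (λ _ → Subset.∈⊤) , Subset.∣⊤∣≡n (suc n)

module Update {n : ℕ} {X : Fin n → Set} where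

  _[_≔_] : (∀ i → X i) → ∀ k → X k → ∀ i → X i
  (c [ k ≔ x ]) i with i Fin.≟ k
  ... | yes refl = x
  ... | no _     = c i

  ≔-same : ∀ c k x → (c [ k ≔ x ]) k ≡ x
  ≔-same c k x with k Fin.≟ k
  ... | yes refl = refl
  ... | no k≢k   = ⊥-elim (k≢k refl)

  ≔-other : ∀ c k x {i} → i ≢ k → (c [ k ≔ x ]) i ≡ c i
  ≔-other c k x {i} i≢k with i Fin.≟ k
  ... | yes i≡k = ⊥-elim (i≢k i≡k)
  ... | no _    = refl

  ≔-rel : ∀ (ρ : ∀ i → X i → X i → Set) (b c : ∀ i → X i) k x →
          (∀ i → ρ i (b i) (c i)) → ρ k (b k) x → ∀ i → ρ i (b i) ((c [ k ≔ x ]) i)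
  ≔-rel ρ b c k x bρc bkρx i with i Fin.≟ k
  ... | yes refl = bkρx
  ... | no _     = bρc i

-- Generation of the blow-up.

module _ (σ : Signature) (𝒱 : Variety σ) (e : ℕ) (hasCube : HasCubeTerm σ 𝒱 (suc (suc e)))
         (n : ℕ) (d≤n : suc (suc e) ≤ n)
         (Bs : Fin n → Algebra σ) (Bs∈𝒱 : ∀ i → _∈V_ σ (Bs i) 𝒱) where

  open Product σ Bs
  open Update {X = λ i → Carrier (Bs i)}

  module _
    (B : Tuple → Set) (B-sub : IsSubuniverse B)
    (θ : (i : Fin n) → Carrier (Bs i) → Carrier (Bs i) → Set)
    (θ-cong : ∀ i → IsCongruence σ (Bs i) (θ i))
    (G : Tuple → Set) (G-gen : Generates G B)
    (Λ Φ : Tuple → Set)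
    (Λ⊆ : ∀ x → Λ x → Blowup θ B x) (Φ⊆ : ∀ x → Φ x → Blowup θ B x)
    (local : ∀ (I : Subset n) → ∣ I ∣ ≡ suc e →
       ∀ (b̄ : Tuple) → B b̄ → ∀ (c̄ : Tuple) → Blowup θ B c̄ → RelOn θ I b̄ c̄ →
       ∃ λ (b : Tuple) → ∃ λ (c : Tuple) →
         B b × Λ c × EqOn I b b̄ × EqOn I c c̄ × ProdRel θ b c)
    (fork : ∀ (i : Fin n) (β̄ : Tuple) → B β̄ → ∀ (γ : Carrier (Bs i)) → θ i (β̄ i) γ →
       ∃ λ (b : Tuple) → ∃ λ (c : Tuple) →
         B b × Φ c × b i ≡ β̄ i × c i ≡ γ ×
         (∀ (j : Fin n) → j <ᶠ i → b j ≡ c j) × ProdRel θ b c) where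

    module θ i = IsEquivalence (IsCongruence.isEquivalence (θ-cong i))

    Gens : Tuple → Set
    Gens = G ∪ Λ ∪ Φ

    Sg-resp : ∀ {X a b} → a ≐ b → Sg X a → Sg X b
    Sg-resp a≐b (gen x x≐a)          = gen x (λ i → trans (x≐a i) (a≐b i))
    Sg-resp a≐b (app f args sg eq)   = app f args sg (λ i → trans (eq i) (a≐b i))

    Sg-mono : ∀ {X Y} → (∀ {x} → X x → Y x) → ∀ {a} → Sg X a → Sg Y a
    Sg-mono X⊆Y (gen x eq)         = gen (X⊆Y x) eq
    Sg-mono X⊆Y (app f args sg eq) = app f args (λ k → Sg-mono X⊆Y (sg k)) eq

    -- B inherits invariance under coordinatewise equality from being generated by G.
    B-resp : ∀ {a b} → a ≐ b → B a → B b
    B-resp a≐b Ba = Equivalence.from (G-gen _) (Sg-resp a≐b (Equivalence.to (G-gen _) Ba))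

    B⊆Sg : ∀ {a} → B a → Sg Gens a
    B⊆Sg Ba = Sg-mono inj₁ (Equivalence.to (G-gen _) Ba)

    θ-resp : ∀ {a a′ b b′} → a ≐ a′ → b ≐ b′ → ProdRel θ a b → ProdRel θ a′ b′
    θ-resp a≐ b≐ aθb i = subst (λ x → θ i x _) (a≐ i) (subst (θ i _) (b≐ i) (aθb i))

    θ-refl : ∀ {a} → ProdRel θ a a
    θ-refl i = θ.refl i

    Blowup-resp : ∀ {a b} → a ≐ b → Blowup θ B a → Blowup θ B b
    Blowup-resp a≐b (c , Bc , cθa) = c , Bc , θ-resp (λ _ → refl) a≐b cθa

    -- Compatibility of θ lets operations act on the witnesses in B.
    Sg⊆Blowup : ∀ {a} → Sg Gens a → Blowup θ B a
    Sg⊆Blowup (gen {x} (inj₁ Gx) eq) =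
      Blowup-resp eq (x , Equivalence.from (G-gen x) (gen Gx (λ _ → refl)) , θ-refl)
    Sg⊆Blowup (gen {x} (inj₂ (inj₁ Λx)) eq) = Blowup-resp eq (Λ⊆ x Λx)
    Sg⊆Blowup (gen {x} (inj₂ (inj₂ Φx)) eq) = Blowup-resp eq (Φ⊆ x Φx)
    Sg⊆Blowup (app f args sg eq) = Blowup-resp eq
      ( prodOp f (λ k → proj₁ (ih k))
      , B-sub f _ (λ k → proj₁ (proj₂ (ih k)))
      , λ i → IsCongruence.compatible (θ-cong i) f _ _ (λ k → proj₂ (proj₂ (ih k)) i) )
      where
      ih : ∀ k → Blowup θ B (args k)
      ih k = Sg⊆Blowup (sg k)

    -- The coordinates (i , false) and (i , true) hold the two components of a pair in B × Sg Gens.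
    PairTuple : Set
    PairTuple = (κ : Fin n × Bool) → Carrier (Bs (proj₁ κ))

    fst snd : PairTuple → Tuple
    fst a i = a (i , false)
    snd a i = a (i , true)

    pair : Tuple → Tuple → PairTuple
    pair b c (i , false) = b i
    pair b c (i , true)  = c i

    -- Keeping the pairs in B and θ-related is what permits hypothesis (2) to be applied to an
    -- approximation.
    R : PairTuple → Set
    R a = B (fst a) × Sg Gens (snd a) × ProdRel θ (fst a) (snd a)

    R-resp : ∀ {a b} → (∀ κ → a κ ≡ b κ) → R a → R b
    R-resp a≐b (Ba , sga , aθ) =
      B-resp (λ i → a≐b _) Ba , Sg-resp (λ i → a≐b _) sga , θ-resp (λ i → a≐b _) (λ i → a≐b _) aθ

    open Schemes {σ} (λ (κ : Fin n × Bool) → Bs (proj₁ κ)) R R-resp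

    abstract
      star : Scheme (suc (suc e)) (Star (suc e)) incStar
      star = let _ , t , _ , cube = hasCube in starScheme (proj₁ cube)
        (cubeScheme
          (λ f as Ras → B-sub f _ (λ k → proj₁ (Ras k))
                      , app f _ (λ k → proj₁ (proj₂ (Ras k))) (λ _ → refl)
                      , λ i → IsCongruence.compatible (θ-cong i) f _ _ (λ k → proj₂ (proj₂ (Ras k)) i))
          {𝒱 = 𝒱} {t = t} (λ κ → Bs∈𝒱 (proj₁ κ)) cube)

    _≈[_]_ : PairTuple → Subset n → PairTuple → Set
    a ≈[ J ] a′ = ∀ κ → proj₁ κ ∈ J → a κ ≡ a′ κ

    Approximable : Subset n → Set
    Approximable J = ∀ b c → B b → ProdRel θ b c → ∃ λ a → R a × a ≈[ J ] pair b c

    small : ∀ J → ∣ J ∣ ≤ suc e → Approximable J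
    small J ∣J∣≤ b c Bb bθc
      with I , J⊆I , ∣I∣ ← enlarge (suc e) J ∣J∣≤ (ℕ.<⇒≤ d≤n)
      with b′ , c′ , Bb′ , Λc′ , b′≡b , c′≡c , b′θc′ ← local I ∣I∣ b Bb c (b , Bb , bθc) (λ i _ → bθc i) =
      pair b′ c′ , (Bb′ , gen (inj₂ (inj₁ Λc′)) (λ _ → refl) , b′θc′) ,
      λ { (i , false) i∈J → b′≡b i (J⊆I i∈J) ; (i , true) i∈J → c′≡c i (J⊆I i∈J) }

    -- The coordinate k is the head of the parallelogram identity and each f r represents one of its
    -- d-1 tail blocks.
    module Grow (J : Subset n) (k : Fin n) (k∈J : k ∈ J) (k-max : ∀ i → i ∈ J → i ≤ᶠ k)
                (f : Fin (suc e) → Fin n) (f-inj : ∀ {r s} → f r ≡ f s → r ≡ s) (f≢k : ∀ r → f r ≢ k)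
                (approx-k : Approximable (J - k)) (approx-f : ∀ r → Approximable (J - f r)) where

      -- Every coordinate of J other than k and the f r may be put in any block, since all the
      -- approximations off f r agree with the target there.
      advance : ∀ b c → B b → ProdRel θ b c → ∀ u v w → R u → R v → R w →
                (∀ i s → i ∈ J → i ≢ k → u (i , s) ≡ pair b c (i , s)) →
                (∀ i s → i ∈ J → i ≢ k → v (i , s) ≡ w (i , s)) →
                (∀ s → u (k , s) ≡ v (k , s)) → (∀ s → w (k , s) ≡ pair b c (k , s)) →
                ∃ λ a → R a × a ≈[ J ] pair b c
      advance b c Bb bθc u v w Ru Rv Rw u≡y v≡w u≡v w≡y =
        parallelogram role Ru Rv Rw (λ r → proj₁ (proj₂ (zs r)))
        where
        zs : ∀ r → ∃ λ a → R a × a ≈[ J - f r ] pair b c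
        zs r = approx-f r b c Bb bθc
        open Parallelogram star (λ κ → proj₁ κ ∈ J) u v w (pair b c) (λ r → proj₁ (zs r))
        z≡y : ∀ r i s → i ∈ J → i ≢ f r → proj₁ (zs r) (i , s) ≡ pair b c (i , s)
        z≡y r i s i∈J i≢f = proj₂ (proj₂ (zs r)) (i , s) (Subset.x∈p∧x≢y⇒x∈p-y i∈J i≢f)
        role : ∀ κ → Role κ
        role (i , s) with i Subset.∈? J
        ... | no i∉J = free i∉J
        ... | yes i∈J with i Fin.≟ k
        ...   | yes refl = head (u≡v s) (w≡y s) (λ r → z≡y r i s i∈J (λ i≡f → f≢k r (sym i≡f)))
        ...   | no i≢k with Fin.any? (λ r → f r Fin.≟ i)
        ...     | yes (r , refl) = tail r (u≡y i s i∈J i≢k) (v≡w i s i∈J i≢k)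
                                     (λ r′ r′≢r → z≡y r′ i s i∈J (λ eq → r′≢r (sym (f-inj eq))))
        -- Block 0 exists because d > 1.
        ...     | no i∉f = tail zero (u≡y i s i∈J i≢k) (v≡w i s i∈J i≢k)
                             (λ r _ → z≡y r i s i∈J (λ eq → i∉f (r , sym eq)))

      <k : ∀ {i} → i ∈ J → i ≢ k → i <ᶠ k
      <k i∈J i≢k = Fin.≤∧≢⇒< (k-max _ i∈J) i≢k

      diag : ∀ {b} → B b → R (pair b b)
      diag Bb = Bb , B⊆Sg Bb , θ-refl

      -- An approximation (b₀ , c₀) off k is moved at k along (b₀ , c₀) → (b₀ , b₀) → (b , b) → (b , c),
      -- by forks from Φ in the outer steps and by the fork (b₀ , b) of B, which exists because
      -- b₀ and b agree on J - k, in the middle one.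
      approx : Approximable J
      approx b c Bb bθc =
        let a₀ , Ra₀ , a₀≈ = approx-k b c Bb bθc
            Bb₀ , _ , b₀θc₀ = Ra₀
            e₁ , g₁ , Be₁ , Φg₁ , e₁k , g₁k , e₁≡g₁ , e₁θg₁ = fork k (fst a₀) Bb₀ (snd a₀ k) (b₀θc₀ k)
            -- In each use of `advance`, u is the current approximation, while v and w carry the old
            -- and the new values at k and agree on the rest of J.
            a₁ , Ra₁ , a₁≈ = advance (fst a₀) (snd a₀ [ k ≔ fst a₀ k ]) Bb₀
               (≔-rel θ (fst a₀) (snd a₀) k (fst a₀ k) b₀θc₀ (θ.refl k))
               a₀ (pair e₁ g₁) (pair e₁ e₁)
               Ra₀ (Be₁ , gen (inj₂ (inj₂ Φg₁)) (λ _ → refl) , e₁θg₁) (diag Be₁)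
               (λ { i false _ _ → refl ; i true _ i≢k → sym (≔-other (snd a₀) k (fst a₀ k) i≢k) })
               (λ { i false _ _ → refl ; i true i∈J i≢k → sym (e₁≡g₁ i (<k i∈J i≢k)) })
               (λ { false → sym e₁k ; true → sym g₁k })
               (λ { false → e₁k ; true → trans e₁k (sym (≔-same (snd a₀) k (fst a₀ k))) })
            -- Both components now have the value b₀ at k, so the move to b uses diagonal pairs of B
            -- only.
            a₂ , Ra₂ , a₂≈ = advance b (c [ k ≔ b k ]) Bb (≔-rel θ b c k (b k) bθc (θ.refl k))
               a₁ (pair (fst a₀) (fst a₀)) (pair b b) Ra₁ (diag Bb₀) (diag Bb)
               (λ { i false i∈J i≢k → trans (a₁≈ (i , false) i∈J) (a₀≈ (i , false) (Subset.x∈p∧x≢y⇒x∈p-y i∈J i≢k))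
                  ; i true i∈J i≢k → trans (a₁≈ (i , true) i∈J)
                      (trans (≔-other (snd a₀) k (fst a₀ k) i≢k)
                      (trans (a₀≈ (i , true) (Subset.x∈p∧x≢y⇒x∈p-y i∈J i≢k))
                             (sym (≔-other c k (b k) i≢k)))) })
               (λ { i false i∈J i≢k → a₀≈ (i , false) (Subset.x∈p∧x≢y⇒x∈p-y i∈J i≢k)
                  ; i true i∈J i≢k → a₀≈ (i , false) (Subset.x∈p∧x≢y⇒x∈p-y i∈J i≢k) })
               (λ { false → a₁≈ (k , false) k∈J
                  ; true → trans (a₁≈ (k , true) k∈J) (≔-same (snd a₀) k (fst a₀ k)) })
               (λ { false → refl ; true → sym (≔-same c k (b k)) })
            -- This fork is traversed from its diagonal pair to (e₂, g₂), opposite to the first one.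
            e₂ , g₂ , Be₂ , Φg₂ , e₂k , g₂k , e₂≡g₂ , e₂θg₂ = fork k b Bb (c k) (bθc k)
        in advance b c Bb bθc a₂ (pair e₂ e₂) (pair e₂ g₂)
          Ra₂ (diag Be₂) (Be₂ , gen (inj₂ (inj₂ Φg₂)) (λ _ → refl) , e₂θg₂)
          (λ { i false i∈J i≢k → a₂≈ (i , false) i∈J
             ; i true i∈J i≢k → trans (a₂≈ (i , true) i∈J) (≔-other c k (b k) i≢k) })
          (λ { i false _ _ → refl ; i true i∈J i≢k → e₂≡g₂ i (<k i∈J i≢k) })
          (λ { false → trans (a₂≈ (k , false) k∈J) (sym e₂k)
             ; true → trans (a₂≈ (k , true) k∈J) (trans (≔-same c k (b k)) (sym e₂k)) })
          (λ { false → e₂k ; true → g₂k })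

    approximable : ∀ N J → ∣ J ∣ < N → Approximable J
    approximable (suc N) J (s≤s ∣J∣≤N) with ∣ J ∣ ℕ.≤? suc e
    ... | yes ∣J∣≤ = small J ∣J∣≤
    ... | no ∣J∣≰
      with k , k∈J , k-max ← maximum J (ℕ.≤-trans (s≤s z≤n) (ℕ.≰⇒> ∣J∣≰))
      with f , f∈J , f-mono ← enumerate (suc (suc e)) J (ℕ.≰⇒> ∣J∣≰) =
      Grow.approx J k k∈J k-max g g-inj g≢k (smaller k k∈J) (λ r → smaller (g r) (f∈J (inject₁ r)))
      where
      -- Of d increasing elements of J the last is dropped, so the others lie strictly below k.
      g : Fin (suc e) → Fin n
      g r = f (inject₁ r)
      smaller : ∀ i → i ∈ J → Approximable (J - i)
      smaller i i∈J = approximable N (J - i) (ℕ.≤-trans (Subset.x∈p⇒∣p-x∣<∣p∣ i∈J) ∣J∣≤N)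
      g-inj : ∀ {r s} → g r ≡ g s → r ≡ s
      g-inj {r} {s} eq with Fin.<-cmp (inject₁ r) (inject₁ s)
      ... | tri< r<s _ _ = ⊥-elim (Fin.<⇒≢ (f-mono _ _ r<s) eq)
      ... | tri≈ _ r≡s _ = Fin.inject₁-injective r≡s
      ... | tri> _ _ s<r = ⊥-elim (Fin.<⇒≢ (f-mono _ _ s<r) (sym eq))
      g≢k : ∀ r → g r ≢ k
      g≢k r = Fin.<⇒≢ (ℕ.<-≤-trans (f-mono (inject₁ r) (fromℕ (suc e)) last) (k-max _ (f∈J _)))
        where
        last : inject₁ r <ᶠ fromℕ (suc e)
        last rewrite Fin.toℕ-inject₁ r | Fin.toℕ-fromℕ (suc e) = Fin.toℕ<n r

    generates : Generates (G ∪ Λ ∪ Φ) (Blowup θ B)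
    generates c = mk⇔ Blowup⊆Sg Sg⊆Blowup
      where
      Blowup⊆Sg : Blowup θ B c → Sg Gens c
      Blowup⊆Sg (b , Bb , bθc)
        with a , (_ , sga , _) , a≈ ← approximable (suc ∣ ⊤ {n} ∣) ⊤ ℕ.≤-refl b c Bb bθc =
        Sg-resp (λ i → a≈ (i , true) Subset.∈⊤) sga

theorem3p11 : (σ : Signature) (𝒱 : Variety σ) (d : ℕ) → HasCubeTerm σ 𝒱 d → 1 < d →
    (n : ℕ) → d ≤ n →
    (Bs : Fin n → Algebra σ) → (∀ i → _∈V_ σ (Bs i) 𝒱) →
    let open Product σ Bs in
    (B : Tuple → Set) → IsSubuniverse B →
    (θ : (i : Fin n) → Carrier (Bs i) → Carrier (Bs i) → Set) →
    (∀ i → IsCongruence σ (Bs i) (θ i)) →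
    (G : Tuple → Set) → Generates G B →
    (Λ Φ : Tuple → Set) →
    (∀ x → Λ x → Blowup θ B x) → (∀ x → Φ x → Blowup θ B x) →
    (∀ (I : Subset n) → ∣ I ∣ ≡ d ∸ 1 →
    ∀ (b̄ : Tuple) → B b̄ → ∀ (c̄ : Tuple) → Blowup θ B c̄ → RelOn θ I b̄ c̄ →
    ∃ λ (b : Tuple) → ∃ λ (c : Tuple) →
    B b × Λ c × EqOn I b b̄ × EqOn I c c̄ × ProdRel θ b c) →
    (∀ (i : Fin n) (β̄ : Tuple) → B β̄ → ∀ (γ : Carrier (Bs i)) → θ i (β̄ i) γ →
    ∃ λ (b : Tuple) → ∃ λ (c : Tuple) →
    B b × Φ c × b i ≡ β̄ i × c i ≡ γ ×
    (∀ (j : Fin n) → j <ᶠ i → b j ≡ c j) × ProdRel θ b c) →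
    Generates (G ∪ Λ ∪ Φ) (Blowup θ B)
theorem3p11 σ 𝒱 (suc (suc e)) hasCube (s≤s (s≤s z≤n)) n d≤n = generates σ 𝒱 e hasCube n d≤n
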